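{- Let $N=pq$ with $p,q$ distinct primes. Let $d\in\mathbb{N}$ and $b_1,\dots,b_d\in\mathbb{Z}$. For each $i$ let $f_i=n_{2,i}X^2+n_{1,i}X+n_{0,i}\in\mathbb{Z}[X]$ be a polynomial of degree $2$ with $f_i(b_i)=N$. Suppose $\gcd(n_{2,i}b_i,N)=1$ for every $i$, and define $b_{d+i}:=n_{0,i}\cdot n_{2,i}^{ -1}\cdot b_i^{ -1}\bmod N$ for $1\le i\le d$ (inverses taken modulo $N$). If $\gcd(b_j-b_k,N)=1$ for all $j,k\in\{1,\dots,2d\}$ with $j\neq k$, then \[\nu\Big(\prod_{i=1}^d f_i\Big)=2dp+2dq-8d^2.\]
   Context: $Z_N=\{0,1,\dots,N-1\}$. For $g\in\mathbb{Z}[X]$, an element $x\in Z_N$ is called suitable for $g$ if $1<\gcd(g(x),N)<N$, and $\nu(g)$ denotes the number of $x\in Z_N$ suitable for $g$. -}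

module Defs where

open import Data.Fin.Base using (Fin; toℕ; fromℕ<)
open import Data.Fin.Properties using (any?; toℕ-fromℕ<)
open import Data.Integer.Base hiding (NonZero)
open import Data.Integer.DivMod using (n%ℕd<d; a≡a%ℕn+[a/ℕn]*n)
open import Data.Integer.Divisibility.Signed using (_∣_; _∣?_; divides)
open import Data.Integer.GCD using (gcd)
import Data.Integer.Properties as ℤₚ
open import Data.Integer.Tactic.RingSolver using (solve-∀)
open import Data.List.Base using (List; []; _∷_; map; length; filter; upTo)
open import Data.Nat.Base as ℕ using (ℕ; NonZero)
import Data.Nat.GCD as ℕᵍ
import Data.Nat.Properties as ℕₚ
open import Data.Nat.Primality using (Prime; prime⇒nonZero)
open import Data.Product.Base using (∃; _×_; _,_)
open import Data.Vec.Functional using (Vector; foldr)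
open import Relation.Binary.PropositionalEquality
open import Relation.Nullary using (Dec; yes; no; contradiction)
open import Relation.Nullary.Decidable using (_×-dec_)

-- Integer polynomials as coefficient lists, constant coefficient first;
-- trailing zeros are allowed.

ℤ[X] : Set
ℤ[X] = List ℤ

infixl 6 _⊕_
infixl 7 _⊗_

_⊕_ : ℤ[X] → ℤ[X] → ℤ[X]
[]      ⊕ g       = g
(a ∷ f) ⊕ []      = a ∷ f
(a ∷ f) ⊕ (b ∷ g) = (a + b) ∷ (f ⊕ g)

_⊗_ : ℤ[X] → ℤ[X] → ℤ[X]
[]      ⊗ g = []
(a ∷ f) ⊗ g = map (a *_) g ⊕ (0ℤ ∷ (f ⊗ g))

∏ : ∀ {d} → Vector ℤ[X] d → ℤ[X]
∏ = foldr _⊗_ (1ℤ ∷ [])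

eval : ℤ[X] → ℤ → ℤ
eval []      x = 0ℤ
eval (a ∷ f) x = a + x * eval f x

Suitable : ℕ → ℤ[X] → ℕ → Set
Suitable N g x = 1ℤ < gcd (eval g (+ x)) (+ N) × gcd (eval g (+ x)) (+ N) < + N

suitable? : ∀ N g x → Dec (Suitable N g x)
suitable? N g x = (_ ℤₚ.<? _) ×-dec (_ ℤₚ.<? _)

ν : ℕ → ℤ[X] → ℕ
ν N g = length (filter (suitable? N g) (upTo N))

Inverse : (N : ℕ) → ℤ → Fin N → Set
Inverse N a y = + N ∣ a * + toℕ y - 1ℤ

inverse? : ∀ N a → Dec (∃ (Inverse N a))
inverse? N a = any? (λ y → + N ∣? a * + toℕ y - 1ℤ)

-- The inverse of a modulo N, as an element of {0, …, N - 1}. The value 0 for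
-- non-invertible a is junk; `inverse-correct` covers every a coprime to N.

inverse : ℕ → ℤ → ℤ
inverse N a with inverse? N a
... | yes (y , _) = + toℕ y
... | no _        = 0ℤ

private
  bézout : ∀ m n → ℕᵍ.gcd m n ≡ 1 → ∃ λ u → + n ∣ + m * u - 1ℤ
  bézout m n eq with ℕᵍ.Bézout.identity (subst (ℕᵍ.GCD.GCD m n) eq (ℕᵍ.gcd-GCD m n))
  ... | ℕᵍ.Bézout.+- x y e = + x , divides (+ y) (begin
    + m * + x - 1ℤ         ≡⟨ cong (_- 1ℤ) (trans (ℤₚ.*-comm (+ m) (+ x)) (sym (ℤₚ.pos-* x m))) ⟩
    + (x ℕ.* m) - 1ℤ       ≡⟨ cong (λ z → + z - 1ℤ) e ⟨
    1ℤ + + (y ℕ.* n) - 1ℤ  ≡⟨ cong (λ z → 1ℤ + z - 1ℤ) (ℤₚ.pos-* y n) ⟩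
    1ℤ + + y * + n - 1ℤ    ≡⟨ lem (+ y * + n) ⟩
    + y * + n              ∎)
    where
    open ≡-Reasoning
    lem : ∀ z → 1ℤ + z - 1ℤ ≡ z
    lem = solve-∀
  ... | ℕᵍ.Bézout.-+ x y e = - + x , divides (- + y) (begin
    + m * - + x - 1ℤ        ≡⟨ lem (+ m) (+ x) ⟩
    - (1ℤ + + x * + m)      ≡⟨ cong (λ z → - (1ℤ + z)) (ℤₚ.pos-* x m) ⟨
    - (1ℤ + + (x ℕ.* m))    ≡⟨ cong (λ z → - (+ z)) e ⟩
    - (+ (y ℕ.* n))         ≡⟨ cong -_ (ℤₚ.pos-* y n) ⟩
    - (+ y * + n)           ≡⟨ ℤₚ.neg-distribˡ-* (+ y) (+ n) ⟩
    - + y * + n             ∎)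
    where
    open ≡-Reasoning
    lem : ∀ m x → m * - x - 1ℤ ≡ - (1ℤ + x * m)
    lem = solve-∀

  bézoutℤ : ∀ a N → gcd a (+ N) ≡ 1ℤ → ∃ λ u → + N ∣ a * u - 1ℤ
  bézoutℤ (+ m)      N eq = bézout m N (ℤₚ.+-injective eq)
  bézoutℤ a@(-[1+ m ]) N eq with bézout (ℕ.suc m) N (ℤₚ.+-injective eq)
  ... | u , divides k e = - u , divides k (trans (lem (+ ℕ.suc m) u) e)
    where
    lem : ∀ m u → - m * - u - 1ℤ ≡ m * u - 1ℤ
    lem = solve-∀

  inverse-exists : ∀ N .{{_ : NonZero N}} a → gcd a (+ N) ≡ 1ℤ → ∃ (Inverse N a)
  inverse-exists N a eq with bézoutℤ a N eq
  ... | u , divides k e = fromℕ< r<N , subst (λ r → + N ∣ a * + r - 1ℤ)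
                            (sym (toℕ-fromℕ< r<N)) (divides (k - a * q) (begin
    a * + r - 1ℤ                         ≡⟨ lem₁ a (+ r) (q * + N) ⟩
    (a * (+ r + q * + N) - 1ℤ) - a * (q * + N)
      ≡⟨ cong (λ z → (a * z - 1ℤ) - a * (q * + N)) (a≡a%ℕn+[a/ℕn]*n u N) ⟨
    (a * u - 1ℤ) - a * (q * + N)         ≡⟨ cong (_- a * (q * + N)) e ⟩
    k * + N - a * (q * + N)              ≡⟨ lem₂ k a q (+ N) ⟩
    (k - a * q) * + N                    ∎))
    where
    open ≡-Reasoning
    r : ℕ
    r = u %ℕ N
    q : ℤ
    q = u /ℕ N
    r<N : r ℕ.< N
    r<N = n%ℕd<d u N
    lem₁ : ∀ a r s → a * r - 1ℤ ≡ (a * (r + s) - 1ℤ) - a * s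
    lem₁ = solve-∀
    lem₂ : ∀ k a q n → k * n - a * (q * n) ≡ (k - a * q) * n
    lem₂ = solve-∀

inverse-correct : ∀ N .{{_ : NonZero N}} a → gcd a (+ N) ≡ 1ℤ →
                  + N ∣ a * inverse N a - 1ℤ
inverse-correct N a eq with inverse? N a
... | yes (_ , p) = p
... | no ¬p       = contradiction (inverse-exists N a eq) ¬p

prime*prime-nonZero : ∀ {p q} → Prime p → Prime q → NonZero (p ℕ.* q)
prime*prime-nonZero {p} {q} pp pq =
  ℕₚ.m*n≢0 p q {{prime⇒nonZero pp}} {{prime⇒nonZero pq}}

-- For l ∈ {p , q}, the polynomial f i has exactly the roots b i and b (d + i)
-- modulo l, and these 2 d values are distinct modulo l, so ∏ f has exactly 2 d
-- roots modulo l. An x is suitable iff exactly one of p, q divides the value at x.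
-- By inclusion–exclusion the number of such x is 2 d q + 2 d p − 2 (2 d)², since
-- x runs over all residues modulo p q and, by the Chinese remainder theorem, each
-- pair of a residue modulo p and one modulo q is hit exactly once.

module Submission where

open import Defs
open import Data.Integer.Base using (ℤ; +_; 0ℤ; 1ℤ; _+_; _-_; -_; _*_; _%ℕ_; _/ℕ_; ∣_∣; +<+)
open import Data.Integer.DivMod using (a≡a%ℕn+[a/ℕn]*n; n%ℕd<d)
open import Data.Integer.Divisibility.Signed
open import Data.Integer.GCD using (gcd)
import Data.Integer.Properties as ℤₚ
open import Data.Integer.Tactic.RingSolver using (solve-∀)
open import Data.Fin.Base using (Fin; zero; suc; toℕ; fromℕ<; splitAt; _↑ˡ_; _↑ʳ_)
import Data.Fin.Properties as Fin
open import Data.Fin.Properties using (toℕ-fromℕ<; toℕ-injective; toℕ<n; suc-injective)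
open import Data.List.Base using ([]; _∷_; map; length; filter; applyUpTo)
open import Data.Nat.Base as ℕ using (ℕ; zero; suc; NonZero)
import Data.Nat.Coprimality as Coprimality
open Coprimality using (Coprime; coprime-divisor; coprime⇒gcd≡1; gcd≡1⇒coprime)
import Data.Nat.Divisibility as ℕᵈ
import Data.Nat.GCD as ℕᵍ
import Data.Nat.Properties as ℕₚ
open import Data.Nat.Primality using (Prime; prime⇒nonZero; prime⇒nonTrivial; prime⇒irreducible; euclidsLemma)
open import Data.Nat.Tactic.RingSolver using () renaming (solve-∀ to solveℕ-∀)
open import Data.Product.Base using (∃; _×_; _,_; proj₁; proj₂)
open import Data.Sum.Base as Sum using (_⊎_; inj₁; inj₂)
open import Data.Vec.Functional using (Vector; _++_)
open import Data.Vec.Functional.Properties using (lookup-++ˡ; lookup-++ʳ)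
open import Function.Base using (_∘_; id)
open import Function.Bundles using (_⇔_; mk⇔; Equivalence)
open import Relation.Binary.PropositionalEquality
open import Relation.Nullary using (Dec; yes; no; ¬_; contradiction)
open import Relation.Nullary.Decidable using (_×-dec_)
open import Relation.Unary using (Decidable)
open import Algebra.Properties.Semiring.Sum ℕₚ.+-*-semiring
  using (sum; sum-syntax; sum-cong-≗; ∑-distrib-+; ∑-comm; *-distribˡ-sum; *-distribʳ-sum)

open Equivalence using (to; from)

private
  variable
    A B S : Set
    n p q : ℕ

-- Indicators and finite sums

𝟙 : Dec A → ℕ
𝟙 (yes _) = 1
𝟙 (no _)  = 0

𝟙-× : (A? : Dec A) (B? : Dec B) → 𝟙 (A? ×-dec B?) ≡ 𝟙 A? ℕ.* 𝟙 B?
𝟙-× (yes _) (yes _) = refl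
𝟙-× (yes _) (no _)  = refl
𝟙-× (no _)  (yes _) = refl
𝟙-× (no _)  (no _)  = refl

-- The four hypotheses say that `S` is the exclusive or of `A` and `B`. The overlap is added on the
-- left because subtraction on ℕ truncates.
𝟙-xor : (S? : Dec S) (A? : Dec A) (B? : Dec B) →
        (A → B → ¬ S) → (A → ¬ B → S) → (¬ A → B → S) → (¬ A → ¬ B → ¬ S) →
        𝟙 S? ℕ.+ 2 ℕ.* (𝟙 A? ℕ.* 𝟙 B?) ≡ 𝟙 A? ℕ.+ 𝟙 B?
𝟙-xor (yes s) (yes a) (yes b) ab _ _ _ = contradiction s (ab a b)
𝟙-xor (no _)  (yes _) (yes _) _ _ _ _  = refl
𝟙-xor (yes _) (yes _) (no _)  _ _ _ _  = refl
𝟙-xor (no ¬s) (yes a) (no ¬b) _ a¬b _ _ = contradiction (a¬b a ¬b) ¬s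
𝟙-xor (yes _) (no _)  (yes _) _ _ _ _  = refl
𝟙-xor (no ¬s) (no ¬a) (yes b) _ _ ¬ab _ = contradiction (¬ab ¬a b) ¬s
𝟙-xor (yes s) (no ¬a) (no ¬b) _ _ _ ¬a¬b = contradiction s (¬a¬b ¬a ¬b)
𝟙-xor (no _)  (no _)  (no _)  _ _ _ _  = refl

sum-const : ∀ n c → ∑[ i < n ] c ≡ n ℕ.* c
sum-const zero    c = refl
sum-const (suc n) c = cong (c ℕ.+_) (sum-const n c)

sum-𝟙-∄ : {P : Fin n → Set} (P? : Decidable P) → (∀ i → ¬ P i) → ∑[ i < n ] 𝟙 (P? i) ≡ 0
sum-𝟙-∄ {zero}  P? ∄P = refl
sum-𝟙-∄ {suc n} P? ∄P with P? zero
... | yes P0 = contradiction P0 (∄P zero)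
... | no _   = sum-𝟙-∄ (P? ∘ suc) (∄P ∘ suc)

sum-𝟙-∃! : {P : Fin n → Set} (P? : Decidable P) (i : Fin n) → P i →
           (∀ j → P j → i ≡ j) → ∑[ j < n ] 𝟙 (P? j) ≡ 1
sum-𝟙-∃! P? zero P0 unique with P? zero
... | yes _  = cong suc (sum-𝟙-∄ (P? ∘ suc) λ j Pj → Fin.0≢1+n (unique (suc j) Pj))
... | no ¬P0 = contradiction P0 ¬P0
sum-𝟙-∃! P? (suc i) Pi unique with P? zero
... | yes P0 = contradiction (unique zero P0) λ ()
... | no _   = sum-𝟙-∃! (P? ∘ suc) i Pi λ j Pj → suc-injective (unique (suc j) Pj)

-- Uniqueness leaves at most one nonzero summand. This turns the indicator of a prime dividing a
-- polynomial value into a sum over roots, which can be exchanged with the sum over `x`.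
sum-𝟙-unique : {P : Fin n → Set} (P? : Decidable P) (A? : Dec A) → A ⇔ ∃ P →
               (∀ i j → P i → P j → i ≡ j) → ∑[ i < n ] 𝟙 (P? i) ≡ 𝟙 A?
sum-𝟙-unique P? (yes a) A⇔∃P unique with to A⇔∃P a
... | i , Pi = sum-𝟙-∃! P? i Pi (λ j → unique i j Pi)
sum-𝟙-unique P? (no ¬a) A⇔∃P unique = sum-𝟙-∄ P? λ i Pi → ¬a (from A⇔∃P (i , Pi))

-- `upTo n` is `applyUpTo id n`; a general `f` lets the induction pass to `f ∘ suc`.
length-filter-applyUpTo : {P : ℕ → Set} (P? : Decidable P) (f : ℕ → ℕ) (n : ℕ) →
  length (filter P? (applyUpTo f n)) ≡ ∑[ i < n ] 𝟙 (P? (f (toℕ i)))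
length-filter-applyUpTo P? f zero = refl
length-filter-applyUpTo P? f (suc n) with P? (f 0)
... | yes _ = cong suc (length-filter-applyUpTo P? (f ∘ suc) n)
... | no _  = length-filter-applyUpTo P? (f ∘ suc) n

-- Divisibility and congruences

∣-sub-swap : ∀ {k} a b → k ∣ a - b → k ∣ b - a
∣-sub-swap {k} a b k∣ = subst (k ∣_) (lem a b) (∣m⇒∣-m k∣)
  where
  lem : ∀ a b → - (a - b) ≡ b - a
  lem = solve-∀

∣-sub-trans : ∀ {k} a b c → k ∣ a - b → k ∣ b - c → k ∣ a - c
∣-sub-trans {k} a b c k∣₁ k∣₂ = subst (k ∣_) (lem a b c) (∣m∣n⇒∣m+n k∣₁ k∣₂)
  where
  lem : ∀ a b c → (a - b) + (b - c) ≡ a - c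
  lem = solve-∀

+∣+ : ∀ {m n} → m ℕᵈ.∣ n → + m ∣ + n
+∣+ = ∣ᵤ⇒∣

∣-%ℕ : ∀ n .{{_ : NonZero n}} y → + n ∣ + (y %ℕ n) - y
∣-%ℕ n y = divides (- (y /ℕ n)) (trans
  (cong (_-_ (+ (y %ℕ n))) (a≡a%ℕn+[a/ℕn]*n y n)) (lem (+ (y %ℕ n)) (y /ℕ n) (+ n)))
  where
  lem : ∀ r k n → r - (r + k * n) ≡ - k * n
  lem = solve-∀

residue : ∀ n .{{_ : NonZero n}} → ℤ → Fin n
residue n y = fromℕ< (n%ℕd<d y n)

∣-residue : ∀ n .{{_ : NonZero n}} y → + n ∣ + toℕ (residue n y) - y
∣-residue n y = subst (λ r → + n ∣ + r - y) (sym (toℕ-fromℕ< (n%ℕd<d y n))) (∣-%ℕ n y)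

-- The difference of two elements of `Fin n` has absolute value below `n`, and the only multiple of
-- `n` in that range is 0.
residue-unique : ∀ {n} (i j : Fin n) → + n ∣ + toℕ i - + toℕ j → i ≡ j
residue-unique {n} i j n∣i-j = toℕ-injective (ℤₚ.+-injective
  (ℤₚ.i-j≡0⇒i≡j (+ toℕ i) (+ toℕ j) (ℤₚ.∣i∣≡0⇒i≡0 (small ∣ + toℕ i - + toℕ j ∣ (∣⇒∣ᵤ n∣i-j) bound))))
  where
  small : ∀ m → n ℕᵈ.∣ m → m ℕ.< n → m ≡ 0
  small zero    _   _   = refl
  small (suc m) n∣m m<n = contradiction n∣m (ℕᵈ.>⇒∤ m<n)

  bound : ∣ + toℕ i - + toℕ j ∣ ℕ.< n
  bound = subst (λ z → ∣ z ∣ ℕ.< n) (sym (ℤₚ.m-n≡m⊖n (toℕ i) (toℕ j)))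
    (ℕₚ.≤-<-trans (ℤₚ.∣m⊝n∣≤m⊔n (toℕ i) (toℕ j)) (ℕₚ.⊔-lub (toℕ<n i) (toℕ<n j)))

-- A common divisor of `a` and `n` is also one of `c` and `n`. With `c` equal to `n₂ * b`, both
-- factors turn out invertible modulo `N`.
gcd≡1-∣ : ∀ {a c n} → a ∣ c → gcd c n ≡ 1ℤ → gcd a n ≡ 1ℤ
gcd≡1-∣ {a} {c} {n} a∣c gcd≡1 = cong +_ (coprime⇒gcd≡1 λ (d∣a , d∣n) →
  gcd≡1⇒coprime {∣ c ∣} {∣ n ∣} (ℤₚ.+-injective gcd≡1) (ℕᵈ.∣-trans d∣a (∣⇒∣ᵤ a∣c) , d∣n))

prime∤1 : Prime p → ¬ p ℕᵈ.∣ 1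
prime∤1 p-prime p∣1 = ℕ.nonTrivial⇒≢1 {{prime⇒nonTrivial p-prime}} (ℕᵈ.∣1⇒≡1 p∣1)

gcd≡1⇒prime∤ : ∀ {a n} → Prime p → + p ∣ n → gcd a n ≡ 1ℤ → ¬ + p ∣ a
gcd≡1⇒prime∤ {a = a} {n} p-prime p∣n gcd≡1 p∣a = prime∤1 p-prime
  (subst (_ ℕᵈ.∣_) (ℤₚ.+-injective gcd≡1) (ℕᵍ.gcd-greatest (∣⇒∣ᵤ p∣a) (∣⇒∣ᵤ p∣n)))

prime∣* : ∀ a b → Prime p → + p ∣ a * b → (+ p ∣ a) ⊎ (+ p ∣ b)
prime∣* a b p-prime p∣ab = Sum.map ∣ᵤ⇒∣ ∣ᵤ⇒∣
  (euclidsLemma ∣ a ∣ ∣ b ∣ p-prime (subst (_ ℕᵈ.∣_) (ℤₚ.abs-* a b) (∣⇒∣ᵤ p∣ab)))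

≢⇒coprime : Prime p → Prime q → p ≢ q → Coprime p q
≢⇒coprime p-prime q-prime p≢q (d∣p , d∣q)
  with prime⇒irreducible p-prime d∣p | prime⇒irreducible q-prime d∣q
... | inj₁ d≡1 | _        = d≡1
... | inj₂ _   | inj₁ d≡1 = d≡1
... | inj₂ d≡p | inj₂ d≡q = contradiction (trans (sym d≡p) d≡q) p≢q

-- Write `n` as `k` times `p`; since `q` is coprime to `p`, it must divide `k`.
coprime-*-∣ : ∀ {n} → Coprime p q → p ℕᵈ.∣ n → q ℕᵈ.∣ n → p ℕ.* q ℕᵈ.∣ n
coprime-*-∣ {p} {q} c (ℕᵈ.divides-refl k) q∣kp = subst (p ℕ.* q ℕᵈ.∣_) (ℕₚ.*-comm p k)
  (ℕᵈ.*-monoʳ-∣ p (coprime-divisor (Coprimality.sym c) (subst (q ℕᵈ.∣_) (ℕₚ.*-comm k p) q∣kp)))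

-- Chinese remaindering

crt : .{{_ : NonZero q}} .{{_ : NonZero (p ℕ.* q)}} → Coprime p q → ∀ r s →
      ∃ λ (x : Fin (p ℕ.* q)) → (+ p ∣ + toℕ x - r) × (+ q ∣ + toℕ x - s)
crt {q} {p} c r s = x ,
    ∣-sub-trans (+ toℕ x) y r (∣-trans (+∣+ (ℕᵈ.m∣m*n q)) (∣-residue (p ℕ.* q) y))
      (divides (u * (s - r)) (lem₁ (+ p) u r s)) ,
    ∣-sub-trans (+ toℕ x) y s (∣-trans (+∣+ (ℕᵈ.n∣m*n p)) (∣-residue (p ℕ.* q) y))
      (subst (+ q ∣_) (lem₂ (+ p) u r s)
        (∣m⇒∣m*n (s - r) (inverse-correct q (+ p) (cong +_ (coprime⇒gcd≡1 c)))))
  where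
  u : ℤ
  u = inverse q (+ p)
  -- The correction to `r` is a multiple of `p`; modulo `q` the factor `p * u` is 1, so the
  -- correction is `s - r` there.
  y : ℤ
  y = r + + p * u * (s - r)
  x : Fin (p ℕ.* q)
  x = residue (p ℕ.* q) y
  lem₁ : ∀ p u r s → r + p * u * (s - r) - r ≡ u * (s - r) * p
  lem₁ = solve-∀
  lem₂ : ∀ p u r s → (p * u - 1ℤ) * (s - r) ≡ r + p * u * (s - r) - s
  lem₂ = solve-∀

-- `crt` supplies a solution. Two solutions differ by a multiple of both `p` and `q`, hence of
-- `p * q`, so they agree.
crt-count : .{{_ : NonZero q}} .{{_ : NonZero (p ℕ.* q)}} → Coprime p q → ∀ r s →
  ∑[ x < p ℕ.* q ] (𝟙 (+ p ∣? + toℕ x - r) ℕ.* 𝟙 (+ q ∣? + toℕ x - s)) ≡ 1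
crt-count {q} {p} c r s = begin
  ∑[ x < p ℕ.* q ] (𝟙 (+ p ∣? + toℕ x - r) ℕ.* 𝟙 (+ q ∣? + toℕ x - s))
    ≡⟨ sum-cong-≗ {p ℕ.* q} (λ x → 𝟙-× (+ p ∣? + toℕ x - r) (+ q ∣? + toℕ x - s)) ⟨
  ∑[ x < p ℕ.* q ] 𝟙 (solution? x)
    ≡⟨ sum-𝟙-∃! solution? (proj₁ x∃) (proj₂ x∃) (unique (proj₁ x∃) (proj₂ x∃)) ⟩
  1 ∎
  where
  open ≡-Reasoning

  Solution : Fin (p ℕ.* q) → Set
  Solution x = (+ p ∣ + toℕ x - r) × (+ q ∣ + toℕ x - s)

  solution? : Decidable Solution
  solution? x = (+ p ∣? + toℕ x - r) ×-dec (+ q ∣? + toℕ x - s)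

  x∃ : ∃ Solution
  x∃ = crt c r s

  unique : ∀ x → Solution x → ∀ y → Solution y → x ≡ y
  unique x (p∣x , q∣x) y (p∣y , q∣y) = residue-unique x y (∣ᵤ⇒∣ (coprime-*-∣ c
    (∣⇒∣ᵤ (∣-sub-trans (+ toℕ x) r (+ toℕ y) p∣x (∣-sub-swap (+ toℕ y) r p∣y)))
    (∣⇒∣ᵤ (∣-sub-trans (+ toℕ x) s (+ toℕ y) q∣x (∣-sub-swap (+ toℕ y) s q∣y)))))

residue-count : ∀ n .{{_ : NonZero n}} y → ∑[ s < n ] 𝟙 (+ n ∣? y - + toℕ s) ≡ 1
residue-count n y = sum-𝟙-∃! (λ s → + n ∣? y - + toℕ s) (residue n y)
  (∣-sub-swap (+ toℕ (residue n y)) y (∣-residue n y))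
  λ s n∣y-s → residue-unique (residue n y) s
    (∣-sub-trans (+ toℕ (residue n y)) y (+ toℕ s) (∣-residue n y) n∣y-s)

-- Each residue class modulo p splits into q classes modulo N = p q.
class-count : ∀ {N} → N ≡ p ℕ.* q → .{{_ : NonZero q}} .{{_ : NonZero N}} → Coprime p q → ∀ r →
  ∑[ x < N ] 𝟙 (+ p ∣? + toℕ x - r) ≡ q
class-count {p} {q} refl c r = begin
  ∑[ x < p ℕ.* q ] α x                        ≡⟨ sum-cong-≗ {p ℕ.* q} (λ x → ℕₚ.*-identityʳ (α x)) ⟨
  -- The factor 1 is expanded as a sum over the residues `s` modulo `q`; after the exchange of sums,
  -- each inner sum counts the solutions of one pair of congruences.
  ∑[ x < p ℕ.* q ] (α x ℕ.* 1)                ≡⟨ sum-cong-≗ {p ℕ.* q} (λ x → cong (α x ℕ.*_) (residue-count q (+ toℕ x))) ⟨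
  ∑[ x < p ℕ.* q ] (α x ℕ.* sum (β x))        ≡⟨ sum-cong-≗ {p ℕ.* q} (λ x → *-distribˡ-sum (α x) (β x)) ⟩
  ∑[ x < p ℕ.* q ] ∑[ s < q ] (α x ℕ.* β x s) ≡⟨ ∑-comm {p ℕ.* q} {q} (λ x s → α x ℕ.* β x s) ⟩
  ∑[ s < q ] ∑[ x < p ℕ.* q ] (α x ℕ.* β x s) ≡⟨ sum-cong-≗ {q} (λ s → crt-count c r (+ toℕ s)) ⟩
  ∑[ s < q ] 1                                ≡⟨ sum-const q 1 ⟩
  q ℕ.* 1                                     ≡⟨ ℕₚ.*-identityʳ q ⟩
  q                                           ∎
  where
  open ≡-Reasoning
  α : Vector ℕ (p ℕ.* q)
  α x = 𝟙 (+ p ∣? + toℕ x - r)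
  β : Fin (p ℕ.* q) → Vector ℕ q
  β x s = 𝟙 (+ q ∣? + toℕ x - + toℕ s)

-- Suitability

1<gcd : ∀ a n .{{_ : NonZero n}} → Prime p → p ℕᵈ.∣ a → p ℕᵈ.∣ n → 1 ℕ.< ℕᵍ.gcd a n
1<gcd a n p-prime p∣a p∣n = ℕₚ.≤∧≢⇒< 0<gcd λ 1≡gcd →
  prime∤1 p-prime (subst (_ ℕᵈ.∣_) (sym 1≡gcd) (ℕᵍ.gcd-greatest p∣a p∣n))
  where
  0<gcd : 0 ℕ.< ℕᵍ.gcd a n
  0<gcd = ℕₚ.n≢0⇒n>0 (ℕᵍ.gcd[m,n]≢0 a n (inj₂ (ℕ.≢-nonZero⁻¹ n)))

-- If the gcd were `n`, then `q` would divide it and hence `a`.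
gcd<n : ∀ a n .{{_ : NonZero n}} → q ℕᵈ.∣ n → ¬ q ℕᵈ.∣ a → ℕᵍ.gcd a n ℕ.< n
gcd<n {q} a n q∣n q∤a = ℕₚ.≤∧≢⇒< (ℕᵍ.gcd[m,n]≤n a n) λ gcd≡n →
  q∤a (ℕᵈ.∣-trans (subst (q ℕᵈ.∣_) (sym gcd≡n) q∣n) (ℕᵍ.gcd[m,n]∣m a n))

prime∤⇒coprime : ∀ {a} → Prime p → ¬ p ℕᵈ.∣ a → Coprime p a
prime∤⇒coprime p-prime p∤a (d∣p , d∣a) with prime⇒irreducible p-prime d∣p
... | inj₁ d≡1  = d≡1
... | inj₂ refl = contradiction d∣a p∤a

-- A common divisor `d` of `p * q` and `a` is coprime to `p` because it divides `a`; so it divides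
-- `q`, and `c₂` applies.
coprime-* : ∀ {a} → Coprime p a → Coprime q a → Coprime (p ℕ.* q) a
coprime-* c₁ c₂ (d∣pq , d∣a) = c₂ (coprime-divisor (λ (e∣d , e∣p) → c₁ (e∣p , ℕᵈ.∣-trans e∣d d∣a)) d∣pq , d∣a)

module _ (p-prime : Prime p) (q-prime : Prime q) (p≢q : p ≢ q) where

  private
    N : ℕ
    N = p ℕ.* q

    instance
      p≢0 : NonZero p
      p≢0 = prime⇒nonZero p-prime
      q≢0 : NonZero q
      q≢0 = prime⇒nonZero q-prime
      N≢0 : NonZero N
      N≢0 = prime*prime-nonZero p-prime q-prime

    coprime : Coprime p q
    coprime = ≢⇒coprime p-prime q-prime p≢q

    p∣N : p ℕᵈ.∣ N
    p∣N = ℕᵈ.m∣m*n q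

    q∣N : q ℕᵈ.∣ N
    q∣N = ℕᵈ.n∣m*n p

  -- The gcd of `y` and `N` is `N` if both primes divide `y`, 1 if neither does, and strictly in
  -- between if exactly one does.
  suitable-𝟙 : ∀ g x → let y = eval g (+ x) in
    𝟙 (suitable? N g x) ℕ.+ 2 ℕ.* (𝟙 (+ p ∣? y) ℕ.* 𝟙 (+ q ∣? y)) ≡ 𝟙 (+ p ∣? y) ℕ.+ 𝟙 (+ q ∣? y)
  suitable-𝟙 g x = 𝟙-xor (suitable? N g x) (+ p ∣? y) (+ q ∣? y)
    (λ { p∣y q∣y (_ , +<+ gcd<N) → ℕₚ.<⇒≱ gcd<N (ℕᵈ.∣⇒≤
      {{ℕ.≢-nonZero (ℕᵍ.gcd[m,n]≢0 a N (inj₂ (ℕ.≢-nonZero⁻¹ N)))}}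
      (ℕᵍ.gcd-greatest (coprime-*-∣ coprime (∣⇒∣ᵤ p∣y) (∣⇒∣ᵤ q∣y)) ℕᵈ.∣-refl)) })
    (λ p∣y q∤y → +<+ (1<gcd a N p-prime (∣⇒∣ᵤ p∣y) p∣N) , +<+ (gcd<n a N q∣N (q∤y ∘ ∣ᵤ⇒∣)))
    (λ p∤y q∣y → +<+ (1<gcd a N q-prime (∣⇒∣ᵤ q∣y) q∣N) , +<+ (gcd<n a N p∣N (p∤y ∘ ∣ᵤ⇒∣)))
    (λ { p∤y q∤y (+<+ 1<gcd , _) → ℕₚ.<⇒≢ 1<gcd (sym (coprime⇒gcd≡1 (Coprimality.sym
      (coprime-* (prime∤⇒coprime p-prime (p∤y ∘ ∣ᵤ⇒∣)) (prime∤⇒coprime q-prime (q∤y ∘ ∣ᵤ⇒∣)))))) })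
    where
    y : ℤ
    y = eval g (+ x)
    a : ℕ
    a = ∣ y ∣

  -- Inclusion-exclusion for a polynomial with the same distinct roots modulo both primes

  module _ {m} (g : ℤ[X]) (ρ : Vector ℤ m)
    (roots-p : ∀ x → + p ∣ eval g x ⇔ ∃ λ j → + p ∣ x - ρ j)
    (roots-q : ∀ x → + q ∣ eval g x ⇔ ∃ λ j → + q ∣ x - ρ j)
    (distinct-p : ∀ j k → + p ∣ ρ j - ρ k → j ≡ k)
    (distinct-q : ∀ j k → + q ∣ ρ j - ρ k → j ≡ k) where

    private
      α β : Fin N → Vector ℕ m
      α x j = 𝟙 (+ p ∣? + toℕ x - ρ j)
      β x k = 𝟙 (+ q ∣? + toℕ x - ρ k)

      πα πβ σ : Vector ℕ N
      πα x = 𝟙 (+ p ∣? eval g (+ toℕ x))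
      πβ x = 𝟙 (+ q ∣? eval g (+ toℕ x))
      σ x = 𝟙 (suitable? N g (toℕ x))

      -- Two roots congruent to `x` modulo `p` are congruent to each other, so `distinct-p`
      -- identifies their indices.
      ∑α : ∀ x → sum (α x) ≡ πα x
      ∑α x = sum-𝟙-unique (λ j → + p ∣? + toℕ x - ρ j) (+ p ∣? eval g (+ toℕ x)) (roots-p (+ toℕ x))
        λ j k p∣j p∣k → distinct-p j k
          (∣-sub-trans (ρ j) (+ toℕ x) (ρ k) (∣-sub-swap (+ toℕ x) (ρ j) p∣j) p∣k)

      ∑β : ∀ x → sum (β x) ≡ πβ x
      ∑β x = sum-𝟙-unique (λ j → + q ∣? + toℕ x - ρ j) (+ q ∣? eval g (+ toℕ x)) (roots-q (+ toℕ x))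
        λ j k q∣j q∣k → distinct-q j k
          (∣-sub-trans (ρ j) (+ toℕ x) (ρ k) (∣-sub-swap (+ toℕ x) (ρ j) q∣j) q∣k)

      ∑πα : sum πα ≡ m ℕ.* q
      ∑πα = begin
        ∑[ x < N ] πα x             ≡⟨ sum-cong-≗ {N} ∑α ⟨
        ∑[ x < N ] ∑[ j < m ] α x j ≡⟨ ∑-comm {N} {m} α ⟩
        ∑[ j < m ] ∑[ x < N ] α x j ≡⟨ sum-cong-≗ {m} (λ j → class-count refl coprime (ρ j)) ⟩
        ∑[ j < m ] q                ≡⟨ sum-const m q ⟩
        m ℕ.* q                     ∎
        where open ≡-Reasoning

      ∑πβ : sum πβ ≡ m ℕ.* p
      ∑πβ = begin
        ∑[ x < N ] πβ x             ≡⟨ sum-cong-≗ {N} ∑β ⟨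
        ∑[ x < N ] ∑[ j < m ] β x j ≡⟨ ∑-comm {N} {m} β ⟩
        -- With the primes exchanged, `N` equals `q * p` only propositionally, which is why
        -- `class-count` takes that equation as an argument.
        ∑[ j < m ] ∑[ x < N ] β x j ≡⟨ sum-cong-≗ {m} (λ j → class-count (ℕₚ.*-comm p q) (Coprimality.sym coprime) (ρ j)) ⟩
        ∑[ j < m ] p                ≡⟨ sum-const m p ⟩
        m ℕ.* p                     ∎
        where open ≡-Reasoning

      -- The product of the two root sums runs over pairs of a root modulo `p` and a root modulo
      -- `q`; each of the `m * m` pairs belongs to exactly one `x`.
      ∑πα*πβ : ∑[ x < N ] (πα x ℕ.* πβ x) ≡ m ℕ.* m
      ∑πα*πβ = begin
        ∑[ x < N ] (πα x ℕ.* πβ x)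
          ≡⟨ sum-cong-≗ {N} (λ x → cong₂ ℕ._*_ (∑α x) (∑β x)) ⟨
        ∑[ x < N ] (sum (α x) ℕ.* sum (β x))
          ≡⟨ sum-cong-≗ {N} (λ x → *-distribʳ-sum (sum (β x)) (α x)) ⟩
        ∑[ x < N ] ∑[ j < m ] (α x j ℕ.* sum (β x))
          ≡⟨ sum-cong-≗ {N} (λ x → sum-cong-≗ {m} λ j → *-distribˡ-sum (α x j) (β x)) ⟩
        ∑[ x < N ] ∑[ j < m ] ∑[ k < m ] (α x j ℕ.* β x k)
          ≡⟨ ∑-comm {N} {m} (λ x j → ∑[ k < m ] (α x j ℕ.* β x k)) ⟩
        ∑[ j < m ] ∑[ x < N ] ∑[ k < m ] (α x j ℕ.* β x k)
          ≡⟨ sum-cong-≗ {m} (λ j → ∑-comm {N} {m} (λ x k → α x j ℕ.* β x k)) ⟩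
        ∑[ j < m ] ∑[ k < m ] ∑[ x < N ] (α x j ℕ.* β x k)
          ≡⟨ sum-cong-≗ {m} (λ j → sum-cong-≗ {m} λ k → crt-count coprime (ρ j) (ρ k)) ⟩
        ∑[ j < m ] ∑[ k < m ] 1
          ≡⟨ sum-cong-≗ {m} (λ (j : Fin m) → trans (sum-const m 1) (ℕₚ.*-identityʳ m)) ⟩
        ∑[ j < m ] m
          ≡⟨ sum-const m m ⟩
        m ℕ.* m ∎
        where open ≡-Reasoning

    -- `suitable-𝟙` is summed over all `x`. The equation stays in additive form, so everything up to
    -- here can be counted in ℕ.
    ν-distinct-roots : ν N g ℕ.+ 2 ℕ.* (m ℕ.* m) ≡ m ℕ.* q ℕ.+ m ℕ.* p
    ν-distinct-roots = begin
      ν N g ℕ.+ 2 ℕ.* (m ℕ.* m)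
        ≡⟨ cong₂ ℕ._+_ (length-filter-applyUpTo (suitable? N g) id N) (cong (2 ℕ.*_) (sym ∑πα*πβ)) ⟩
      sum σ ℕ.+ 2 ℕ.* ∑[ x < N ] (πα x ℕ.* πβ x)
        ≡⟨ cong (sum σ ℕ.+_) (*-distribˡ-sum {N} 2 (λ x → πα x ℕ.* πβ x)) ⟩
      sum σ ℕ.+ ∑[ x < N ] (2 ℕ.* (πα x ℕ.* πβ x))
        ≡⟨ ∑-distrib-+ σ (λ x → 2 ℕ.* (πα x ℕ.* πβ x)) ⟨
      ∑[ x < N ] (σ x ℕ.+ 2 ℕ.* (πα x ℕ.* πβ x))
        ≡⟨ sum-cong-≗ {N} (λ x → suitable-𝟙 g (toℕ x)) ⟩
      ∑[ x < N ] (πα x ℕ.+ πβ x)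
        ≡⟨ ∑-distrib-+ πα πβ ⟩
      sum πα ℕ.+ sum πβ
        ≡⟨ cong₂ ℕ._+_ ∑πα ∑πβ ⟩
      m ℕ.* q ℕ.+ m ℕ.* p ∎
      where open ≡-Reasoning

-- Evaluation of polynomials

eval-⊕ : ∀ f g x → eval (f ⊕ g) x ≡ eval f x + eval g x
eval-⊕ []      g       x = sym (ℤₚ.+-identityˡ (eval g x))
eval-⊕ (a ∷ f) []      x = sym (ℤₚ.+-identityʳ (eval (a ∷ f) x))
eval-⊕ (a ∷ f) (b ∷ g) x = trans (cong (λ z → a + b + x * z) (eval-⊕ f g x))
                             (lem a b x (eval f x) (eval g x))
  where
  lem : ∀ a b x y z → a + b + x * (y + z) ≡ (a + x * y) + (b + x * z)
  lem = solve-∀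

eval-map-* : ∀ a g x → eval (map (a *_) g) x ≡ a * eval g x
eval-map-* a []      x = sym (ℤₚ.*-zeroʳ a)
eval-map-* a (b ∷ g) x = trans (cong (λ z → a * b + x * z) (eval-map-* a g x))
                           (lem a b x (eval g x))
  where
  lem : ∀ a b x y → a * b + x * (a * y) ≡ a * (b + x * y)
  lem = solve-∀

eval-⊗ : ∀ f g x → eval (f ⊗ g) x ≡ eval f x * eval g x
eval-⊗ []      g x = sym (ℤₚ.*-zeroˡ (eval g x))
eval-⊗ (a ∷ f) g x = begin
  eval (map (a *_) g ⊕ (0ℤ ∷ f ⊗ g)) x               ≡⟨ eval-⊕ (map (a *_) g) (0ℤ ∷ f ⊗ g) x ⟩
  eval (map (a *_) g) x + (0ℤ + x * eval (f ⊗ g) x)  ≡⟨ cong₂ (λ y z → y + (0ℤ + x * z)) (eval-map-* a g x) (eval-⊗ f g x) ⟩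
  a * eval g x + (0ℤ + x * (eval f x * eval g x))    ≡⟨ lem a x (eval f x) (eval g x) ⟩
  (a + x * eval f x) * eval g x                      ∎
  where
  open ≡-Reasoning
  lem : ∀ a x y z → a * z + (0ℤ + x * (y * z)) ≡ (a + x * y) * z
  lem = solve-∀

-- Euclid's lemma, one factor at a time; the empty product evaluates to 1, which no prime divides.
prime∣eval-∏ : Prime p → ∀ {d} (f : Vector ℤ[X] d) x → + p ∣ eval (∏ f) x ⇔ ∃ λ i → + p ∣ eval (f i) x
prime∣eval-∏ {p} p-prime f x = mk⇔ (fwd f) (λ (i , p∣fi) → bwd f i p∣fi)
  where
  fwd : ∀ {d} (f : Vector ℤ[X] d) → + p ∣ eval (∏ f) x → ∃ λ i → + p ∣ eval (f i) x
  fwd {zero} f p∣1 = contradiction (∣⇒∣ᵤ (subst (+ p ∣_) (lem x) p∣1)) (prime∤1 p-prime)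
    where
    lem : ∀ x → 1ℤ + x * 0ℤ ≡ 1ℤ
    lem = solve-∀
  fwd {suc d} f p∣∏
    with prime∣* (eval (f zero) x) (eval (∏ (f ∘ suc)) x) p-prime
           (subst (+ p ∣_) (eval-⊗ (f zero) (∏ (f ∘ suc)) x) p∣∏)
  ... | inj₁ p∣f0 = zero , p∣f0
  ... | inj₂ p∣∏′ with fwd (f ∘ suc) p∣∏′
  ...   | i , p∣fi = suc i , p∣fi

  bwd : ∀ {d} (f : Vector ℤ[X] d) i → + p ∣ eval (f i) x → + p ∣ eval (∏ f) x
  bwd f zero p∣f0 = subst (+ p ∣_) (sym (eval-⊗ (f zero) (∏ (f ∘ suc)) x))
    (∣m⇒∣m*n (eval (∏ (f ∘ suc)) x) p∣f0)
  bwd f (suc i) p∣fi = subst (+ p ∣_) (sym (eval-⊗ (f zero) (∏ (f ∘ suc)) x))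
    (∣n⇒∣m*n (eval (f zero) x) (bwd (f ∘ suc) i p∣fi))

-- By Vieta, n₀ ≡ n₂ b b′ makes b′ the second root; multiplying f by b spares the inverse of b.
quadratic-roots : Prime p → ∀ n₀ n₁ n₂ b b′ → let f = n₀ ∷ n₁ ∷ n₂ ∷ [] in
  + p ∣ eval f b → + p ∣ n₂ * b * b′ - n₀ → ¬ + p ∣ n₂ * b →
  ∀ x → + p ∣ eval f x ⇔ ((+ p ∣ x - b) ⊎ (+ p ∣ x - b′))
quadratic-roots {p} p-prime n₀ n₁ n₂ b b′ p∣fb p∣vieta p∤n₂b x = mk⇔ fwd bwd
  where
  f : ℤ[X]
  f = n₀ ∷ n₁ ∷ n₂ ∷ []

  -- The exact difference between `b * eval f x` and `n₂ * b` times the two linear factors. Both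
  -- summands vanish modulo `p`, by the Vieta congruence and by the root `b`.
  r : ℤ
  r = (x - b) * (n₂ * b * b′ - n₀) + x * eval f b

  p∣r : + p ∣ r
  p∣r = ∣m∣n⇒∣m+n (∣n⇒∣m*n (x - b) p∣vieta) (∣n⇒∣m*n x p∣fb)

  factored : b * eval f x ≡ (n₂ * b) * ((x - b) * (x - b′)) + r
  factored = lem n₀ n₁ n₂ b b′ x
    where
    lem : ∀ n₀ n₁ n₂ b b′ x → b * (n₀ + x * (n₁ + x * (n₂ + x * 0ℤ))) ≡
      (n₂ * b) * ((x - b) * (x - b′)) +
      ((x - b) * (n₂ * b * b′ - n₀) + x * (n₀ + b * (n₁ + b * (n₂ + b * 0ℤ))))
    lem = solve-∀

  fwd : + p ∣ eval f x → (+ p ∣ x - b) ⊎ (+ p ∣ x - b′)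
  fwd p∣fx = Sum.[ (λ p∣n₂b → contradiction p∣n₂b p∤n₂b) , prime∣* (x - b) (x - b′) p-prime ]
    (prime∣* (n₂ * b) ((x - b) * (x - b′)) p-prime
      (∣m+n∣n⇒∣m (subst (+ p ∣_) factored (∣n⇒∣m*n b p∣fx)) p∣r))

  p∣prod : (+ p ∣ x - b) ⊎ (+ p ∣ x - b′) → + p ∣ (x - b) * (x - b′)
  p∣prod (inj₁ p∣) = ∣m⇒∣m*n (x - b′) p∣
  p∣prod (inj₂ p∣) = ∣n⇒∣m*n (x - b) p∣

  bwd : (+ p ∣ x - b) ⊎ (+ p ∣ x - b′) → + p ∣ eval f x
  -- The extra factor `b` can be cancelled: `p` does not divide it, since it does not divide
  -- `n₂ * b`.
  bwd p∣ = Sum.[ (λ p∣b → contradiction (∣n⇒∣m*n n₂ p∣b) p∤n₂b) , id ]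
    (prime∣* b (eval f x) p-prime
      (subst (+ p ∣_) (sym factored) (∣m∣n⇒∣m+n (∣n⇒∣m*n (n₂ * b) (p∣prod p∣)) p∣r)))

-- The combined list of roots and the second roots modulo `N`

∃-++ : ∀ {m n} {X : Set} {P : X → Set} (xs : Vector X m) (ys : Vector X n) →
       (∃ (P ∘ xs) ⊎ ∃ (P ∘ ys)) ⇔ ∃ (P ∘ (xs ++ ys))
∃-++ {m} {n} {P = P} xs ys = mk⇔ fwd bwd
  where
  fwd : ∃ (P ∘ xs) ⊎ ∃ (P ∘ ys) → ∃ (P ∘ (xs ++ ys))
  fwd (inj₁ (i , Px)) = i ↑ˡ n , subst P (sym (lookup-++ˡ xs ys i)) Px
  fwd (inj₂ (i , Py)) = m ↑ʳ i , subst P (sym (lookup-++ʳ xs ys i)) Py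

  bwd : ∃ (P ∘ (xs ++ ys)) → ∃ (P ∘ xs) ⊎ ∃ (P ∘ ys)
  bwd (j , Pj) with splitAt m j
  ... | inj₁ i = inj₁ (i , Pj)
  ... | inj₂ i = inj₂ (i , Pj)

-- The three summands of the combination replace `c` by `n₀ * u * v`, then `n₂ * u` by 1, then
-- `b * v` by 1. The result is the Vieta congruence that `quadratic-roots` asks for.
inverse-vieta : ∀ N .{{_ : NonZero N}} n₀ n₂ b → gcd (n₂ * b) (+ N) ≡ 1ℤ →
  + N ∣ n₂ * b * + ((n₀ * inverse N n₂ * inverse N b) %ℕ N) - n₀
inverse-vieta N n₀ n₂ b gcd≡1 = subst (+ N ∣_) (lem n₀ n₂ b u v c)
  (∣m∣n⇒∣m+n (∣n⇒∣m*n (n₂ * b) (∣-%ℕ N (n₀ * u * v)))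
    (∣m∣n⇒∣m+n
      (∣n⇒∣m*n (n₀ * (b * v)) (inverse-correct N n₂ (gcd≡1-∣ {n₂} {n₂ * b} {+ N} (∣m⇒∣m*n b ∣-refl) gcd≡1)))
      (∣n⇒∣m*n n₀ (inverse-correct N b (gcd≡1-∣ {b} {n₂ * b} {+ N} (∣n⇒∣m*n n₂ ∣-refl) gcd≡1)))))
  where
  u v c : ℤ
  u = inverse N n₂
  v = inverse N b
  c = + ((n₀ * u * v) %ℕ N)
  lem : ∀ n₀ n₂ b u v c → n₂ * b * (c - n₀ * u * v) +
    (n₀ * (b * v) * (n₂ * u - 1ℤ) + n₀ * (b * v - 1ℤ)) ≡ n₂ * b * c - n₀
  lem = solve-∀

theorem2p11 :
  ∀ (p q : ℕ) (p-prime : Prime p) (q-prime : Prime q) → p ≢ q →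
  let N = p ℕ.* q
      instance
        N-nonZero : NonZero N
        N-nonZero = prime*prime-nonZero p-prime q-prime
  in
  ∀ (d : ℕ) (b n₂ n₁ n₀ : Vector ℤ d) →
  (∀ i → n₂ i ≢ 0ℤ) →
  let f : Vector ℤ[X] d
      f i = n₀ i ∷ n₁ i ∷ n₂ i ∷ []
  in
  (∀ i → eval (f i) (b i) ≡ + N) →
  (∀ i → gcd (n₂ i * b i) (+ N) ≡ 1ℤ) →
  let b′ : Vector ℤ d
      b′ i = + ((n₀ i * inverse N (n₂ i) * inverse N (b i)) %ℕ N)
      b̂ : Vector ℤ (d ℕ.+ d)
      b̂ = b ++ b′
  in
  (∀ j k → j ≢ k → gcd (b̂ j - b̂ k) (+ N) ≡ 1ℤ) →
  + ν N (∏ f) ≡ + (2 ℕ.* d ℕ.* p) + + (2 ℕ.* d ℕ.* q) - + (8 ℕ.* d ℕ.^ 2)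
theorem2p11 p q p-prime q-prime p≢q d b n₂ n₁ n₀ _ fb≡N n₂b-unit distinct =
  final (ν-distinct-roots p-prime q-prime p≢q (∏ f) (b ++ b′)
    (roots p-prime (+∣+ (ℕᵈ.m∣m*n q))) (roots q-prime (+∣+ (ℕᵈ.n∣m*n p)))
    (injective p-prime (+∣+ (ℕᵈ.m∣m*n q))) (injective q-prime (+∣+ (ℕᵈ.n∣m*n p))))
  where
  N : ℕ
  N = p ℕ.* q

  instance
    N-nonZero : NonZero N
    N-nonZero = prime*prime-nonZero p-prime q-prime

  f : Vector ℤ[X] d
  f i = n₀ i ∷ n₁ i ∷ n₂ i ∷ []

  b′ : Vector ℤ d
  b′ i = + ((n₀ i * inverse N (n₂ i) * inverse N (b i)) %ℕ N)

  -- Modulo a prime divisor `l` of `N` the value `N` of `f i` at `b i` is zero, so `quadratic-roots`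
  -- applies to each factor; its two alternatives are then regrouped into one index over `b ++ b′`.
  roots : ∀ {l} → Prime l → + l ∣ + N → ∀ x → + l ∣ eval (∏ f) x ⇔ ∃ λ j → + l ∣ x - (b ++ b′) j
  roots {l} l-prime l∣N x = mk⇔
    (λ l∣∏ → to ∃-roots (choose (to (prime∣eval-∏ l-prime f x) l∣∏)))
    (λ l∣r → from (prime∣eval-∏ l-prime f x) (unchoose (from ∃-roots l∣r)))
    where
    Root : ℤ → Set
    Root r = + l ∣ x - r

    ∃-roots : (∃ (Root ∘ b) ⊎ ∃ (Root ∘ b′)) ⇔ ∃ (Root ∘ (b ++ b′))
    ∃-roots = ∃-++ {P = Root} b b′

    roots-f : ∀ i → + l ∣ eval (f i) x ⇔ (Root (b i) ⊎ Root (b′ i))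
    roots-f i = quadratic-roots l-prime (n₀ i) (n₁ i) (n₂ i) (b i) (b′ i)
      (subst (+ l ∣_) (sym (fb≡N i)) l∣N)
      (∣-trans l∣N (inverse-vieta N (n₀ i) (n₂ i) (b i) (n₂b-unit i)))
      (gcd≡1⇒prime∤ {a = n₂ i * b i} {+ N} l-prime l∣N (n₂b-unit i)) x

    choose : (∃ λ i → + l ∣ eval (f i) x) → ∃ (Root ∘ b) ⊎ ∃ (Root ∘ b′)
    choose (i , l∣fi) = Sum.map (i ,_) (i ,_) (to (roots-f i) l∣fi)

    unchoose : ∃ (Root ∘ b) ⊎ ∃ (Root ∘ b′) → ∃ λ i → + l ∣ eval (f i) x
    unchoose (inj₁ (i , l∣)) = i , from (roots-f i) (inj₁ l∣)
    unchoose (inj₂ (i , l∣)) = i , from (roots-f i) (inj₂ l∣)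

  -- For distinct indices, `l` would be a common divisor of `N` and a difference coprime to `N`.
  injective : ∀ {l} → Prime l → + l ∣ + N → ∀ j k → + l ∣ (b ++ b′) j - (b ++ b′) k → j ≡ k
  injective l-prime l∣N j k l∣ with j Fin.≟ k
  ... | yes j≡k = j≡k
  ... | no j≢k  = contradiction l∣ (gcd≡1⇒prime∤ {a = (b ++ b′) j - (b ++ b′) k} {+ N} l-prime l∣N (distinct j k j≢k))

  -- The count with `m` equal to `d + d`; the overlap term is moved across by a subtraction in ℤ.
  final : ∀ {ν} → ν ℕ.+ 2 ℕ.* ((d ℕ.+ d) ℕ.* (d ℕ.+ d)) ≡ (d ℕ.+ d) ℕ.* q ℕ.+ (d ℕ.+ d) ℕ.* p →
          + ν ≡ + (2 ℕ.* d ℕ.* p) + + (2 ℕ.* d ℕ.* q) - + (8 ℕ.* d ℕ.^ 2)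
  final {ν} eq = begin
    + ν                                                   ≡⟨ cancel (+ ν) (+ (8 ℕ.* d ℕ.^ 2)) ⟩
    + (ν ℕ.+ 8 ℕ.* d ℕ.^ 2) - + (8 ℕ.* d ℕ.^ 2)           ≡⟨ cong (λ z → + z - + (8 ℕ.* d ℕ.^ 2)) eq′ ⟩
    + (2 ℕ.* d ℕ.* p ℕ.+ 2 ℕ.* d ℕ.* q) - + (8 ℕ.* d ℕ.^ 2) ∎
    where
    open ≡-Reasoning
    cancel : ∀ a c → a ≡ a + c - c
    cancel = solve-∀
    square : ∀ d → 8 ℕ.* (d ℕ.* (d ℕ.* 1)) ≡ 2 ℕ.* ((d ℕ.+ d) ℕ.* (d ℕ.+ d))
    square = solveℕ-∀
    double : ∀ d p q → (d ℕ.+ d) ℕ.* q ℕ.+ (d ℕ.+ d) ℕ.* p ≡ 2 ℕ.* d ℕ.* p ℕ.+ 2 ℕ.* d ℕ.* q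
    double = solveℕ-∀
    eq′ : ν ℕ.+ 8 ℕ.* d ℕ.^ 2 ≡ 2 ℕ.* d ℕ.* p ℕ.+ 2 ℕ.* d ℕ.* q
    eq′ = trans (cong (ν ℕ.+_) (square d)) (trans eq (double d p q))
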